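{- Let $n \ge 3$ and let $\boldsymbol{a} = (a_1, a_2, \ldots, a_n)^T$ be a vector of positive integers with $a_1 \le a_2 \le \cdots \le a_n$ whose entries are pairwise coprime, i.e. $\gcd(a_i,a_j)=1$ for all $i,j \in \{1,\ldots,n\}$ with $i \neq j$. Then $$F(\boldsymbol{a}) \le \frac{1}{2}\left(\sqrt{\frac{1}{3}(a_1+a_2+a_3)(a_1+a_2+a_3+2a_1a_2a_3)+\frac{8}{3}(a_1a_2+a_2a_3+a_3a_1)}-a_1-a_2-a_3\right).$$
   Context: For a vector $\boldsymbol{a}=(a_1,\ldots,a_n)^T$ of positive integers with $n\ge 2$ and $\gcd(a_1,\ldots,a_n)=1$, the Frobenius number is $F(\boldsymbol{a}) := \max\{ b \in \mathbb{Z} : b \ne \sum_{i=1}^n a_i z_i \text{ for all } (z_1,\ldots,z_n) \in \mathbb{Z}_{\ge 0}^n \}$, the largest integer (possibly negative) that is not a nonnegative integer combination of the $a_i$. In particular $F(\boldsymbol{a})=-1$ when some $a_i=1$. -}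

module Defs where

open import Data.Nat.Base as ℕ using (ℕ; zero; suc)
import Data.Nat.Properties as ℕₚ
open import Data.Integer.Base as ℤ using (ℤ; +_)
open import Data.Rational.Base
open import Data.Rational.Properties
open import Data.Rational.Solver using (module +-*-Solver)
open import Data.Fin.Base using (Fin)
open import Data.Vec.Functional using (Vector)
open import Data.Product.Base using (∃; ∃-syntax; Σ-syntax; _×_; _,_)
open import Data.Sum.Base using (_⊎_; inj₁; inj₂)
open import Data.Empty using (⊥; ⊥-elim)
open import Relation.Nullary using (¬_; yes; no)
open import Relation.Binary.Definitions using (tri<; tri≈; tri>)
open import Relation.Binary.PropositionalEquality
open import Algebra.Properties.Monoid.Sum ℕₚ.+-0-monoid using (sum-syntax)
open +-*-Solver using (solve; con; _:+_; _:*_; _:=_; :-_)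

Representable : ∀ {n} → Vector ℕ n → ℤ → Set
Representable {n} a b =
  Σ[ z ∈ Vector ℕ n ] b ≡ + (∑[ i < n ] (a i ℕ.* z i))

record IsFrobeniusNumber {n} (a : Vector ℕ n) (F : ℤ) : Set where
  field
    notRepresentable : ¬ Representable a F
    largest          : ∀ b → ¬ Representable a b → b ℤ.≤ F

-- Two-sided Dedekind cuts of ℚ: L p means p < x, and U q means x < q.
record ℝ : Set₁ where
  field
    L U       : ℚ → Set
    inhabited : ∃ L × ∃ U
    L-down    : ∀ {p q} → p < q → L q → L p
    L-open    : ∀ {p} → L p → ∃[ q ] p < q × L q
    U-up      : ∀ {p q} → p < q → U p → U q
    U-open    : ∀ {q} → U q → ∃[ p ] p < q × U p
    disjoint  : ∀ {q} → L q → U q → ⊥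
    located   : ∀ {p q} → p < q → L p ⊎ U q

open ℝ

infix 4 _≤ʳ_

_≤ʳ_ : ℝ → ℝ → Set
x ≤ʳ y = ∀ {q} → L x q → L y q

private

  -1<0 : - 1ℚ < 0ℚ
  -1<0 = negative⁻¹ (- 1ℚ)

  p-1<p : ∀ p → p - 1ℚ < p
  p-1<p p = subst (p - 1ℚ <_) (+-identityʳ p) (+-monoʳ-< p -1<0)

  p<p+1 : ∀ p → p < p + 1ℚ
  p<p+1 p = subst (_< p + 1ℚ) (+-identityʳ p) (+-monoʳ-< p (positive⁻¹ 1ℚ))

fromℚ : ℚ → ℝ
fromℚ x = record
  { L         = _< x
  ; U         = x <_
  ; inhabited = (x - 1ℚ , p-1<p x) , (x + 1ℚ , p<p+1 x)
  ; L-down    = <-trans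
  ; L-open    = λ p<x → let m , p<m , m<x = <-dense p<x in m , p<m , m<x
  ; U-up      = λ p<q x<p → <-trans x<p p<q
  ; U-open    = λ x<q → let m , x<m , m<q = <-dense x<q in m , m<q , x<m
  ; disjoint  = <-asym
  ; located   = loc
  }
  where
  loc : ∀ {p q} → p < q → p < x ⊎ x < q
  loc {p} {q} p<q with p <? x
  ... | yes p<x = inj₁ p<x
  ... | no  p≮x = inj₂ (≤-<-trans (≮⇒≥ p≮x) p<q)

fromℤ : ℤ → ℝ
fromℤ k = fromℚ (k / 1)

infixl 6 _-ʳ_
infixr 7 _*ʳ_
infix  8 √_

-- p < x - s iff p + s < x.
_-ʳ_ : ℝ → ℚ → ℝ
x -ʳ s = record
  { L         = λ p → L x (p + s)
  ; U         = λ p → U x (p + s)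
  ; inhabited = let (l , Ll) , (u , Uu) = inhabited x in
                (l - s , subst (L x) (sym (cancel⁻ l)) Ll) ,
                (u - s , subst (U x) (sym (cancel⁻ u)) Uu)
  ; L-down    = λ p<q → L-down x (+-monoˡ-< s p<q)
  ; L-open    = λ {p} Lp → let r , p+s<r , Lr = L-open x Lp in
                r - s ,
                subst (_< r - s) (cancel⁺ p) (+-monoˡ-< (- s) p+s<r) ,
                subst (L x) (sym (cancel⁻ r)) Lr
  ; U-up      = λ p<q → U-up x (+-monoˡ-< s p<q)
  ; U-open    = λ {q} Uq → let r , r<q+s , Ur = U-open x Uq in
                r - s ,
                subst (r - s <_) (cancel⁺ q) (+-monoˡ-< (- s) r<q+s) ,
                subst (U x) (sym (cancel⁻ r)) Ur
  ; disjoint  = disjoint x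
  ; located   = λ p<q → located x (+-monoˡ-< s p<q)
  }
  where
  cancel⁻ : ∀ r → (r - s) + s ≡ r
  cancel⁻ r = solve 2 (λ r s → (r :+ :- s) :+ s := r) refl r s
  cancel⁺ : ∀ r → (r + s) - s ≡ r
  cancel⁺ r = solve 2 (λ r s → (r :+ s) :+ :- s := r) refl r s

-- p < c x iff p / c < x, since c > 0.
_*ʳ_ : (c : ℚ) .{{_ : Positive c}} → ℝ → ℝ
c *ʳ x = record
  { L         = λ p → L x (p ÷c)
  ; U         = λ p → U x (p ÷c)
  ; inhabited = let (l , Ll) , (u , Uu) = inhabited x in
                (l * c , subst (L x) (sym (cancel* l)) Ll) ,
                (u * c , subst (U x) (sym (cancel* u)) Uu)
  ; L-down    = λ p<q → L-down x (÷-mono p<q)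
  ; L-open    = λ {p} Lp → let r , p÷c<r , Lr = L-open x Lp in
                r * c ,
                subst (_< r * c) (cancel÷ p) (*-monoˡ-<-pos c p÷c<r) ,
                subst (L x) (sym (cancel* r)) Lr
  ; U-up      = λ p<q → U-up x (÷-mono p<q)
  ; U-open    = λ {q} Uq → let r , r<q÷c , Ur = U-open x Uq in
                r * c ,
                subst (r * c <_) (cancel÷ q) (*-monoˡ-<-pos c r<q÷c) ,
                subst (U x) (sym (cancel* r)) Ur
  ; disjoint  = disjoint x
  ; located   = λ p<q → located x (÷-mono p<q)
  }
  where
  instance
    c≢0 : NonZero c
    c≢0 = pos⇒nonZero c
  _÷c : ℚ → ℚ
  p ÷c = p ÷ c
  ÷-mono : ∀ {p q} → p < q → p ÷c < q ÷c
  ÷-mono = *-monoˡ-<-pos (1/ c) {{1/pos⇒pos c}}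
  cancel* : ∀ r → (r * c) ÷c ≡ r
  cancel* r = trans (*-assoc r c (1/ c))
              (trans (cong (r *_) (*-inverseʳ c)) (*-identityʳ r))
  cancel÷ : ∀ r → (r ÷c) * c ≡ r
  cancel÷ r = trans (*-assoc r (1/ c) c)
              (trans (cong (r *_) (*-inverseˡ c)) (*-identityʳ r))

private

  cancel-< : ∀ {x y a b} → x + b ≡ y + a → a < b → x < y
  cancel-< {x} {y} {a} {b} eq a<b with x <? y
  ... | yes x<y = x<y
  ... | no  x≮y = ⊥-elim (<-irrefl (sym eq) (+-mono-≤-< (≮⇒≥ x≮y) a<b))

  sq-mono-< : ∀ {p q} → 0ℚ ≤ p → p < q → p * p < q * q
  sq-mono-< {p} {q} 0≤p p<q = ≤-<-trans
    (*-monoˡ-≤-nonNeg p {{nonNegative 0≤p}} (<⇒≤ p<q))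
    (*-monoˡ-<-pos q {{positive (≤-<-trans 0≤p p<q)}} p<q)

  -- m = (c p + X) / (p + c), where c = X + 1, lies strictly between p and √ X,
  -- because m² - X = (c² - X) (p² - X) / (p + c)².
  module Between (X p : ℚ) (0≤X : 0ℚ ≤ X) (0≤p : 0ℚ ≤ p) where
    c d k t : ℚ
    c = X + 1ℚ
    d = p + c
    k = X * X + c
    t = c * p + X

    instance
      X-nonNeg : NonNegative X
      X-nonNeg = nonNegative 0≤X
      p-nonNeg : NonNegative p
      p-nonNeg = nonNegative 0≤p
      c-pos : Positive c
      c-pos = nonNeg+pos⇒pos X 1ℚ
      d-pos : Positive d
      d-pos = nonNeg+pos⇒pos p c
      d-nonNeg : NonNegative d
      d-nonNeg = pos⇒nonNeg d
      d≢0 : NonZero d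
      d≢0 = pos⇒nonZero d
      dd-pos : Positive (d * d)
      dd-pos = pos*pos⇒pos d d
      dd-nonNeg : NonNegative (d * d)
      dd-nonNeg = pos⇒nonNeg (d * d)
      k-pos : Positive k
      k-pos = nonNeg+pos⇒pos (X * X) {{nonNeg*nonNeg⇒nonNeg X X}} c

    m : ℚ
    m = t ÷ d

    m*d : m * d ≡ t
    m*d = trans (*-assoc t (1/ d) d)
          (trans (cong (t *_) (*-inverseˡ d)) (*-identityʳ t))

    mm*dd : (m * m) * (d * d) ≡ t * t
    mm*dd = trans
      (solve 2 (λ m d → (m :* m) :* (d :* d) := (m :* d) :* (m :* d)) refl m d)
      (cong₂ _*_ m*d m*d)

    lin : p * d + X ≡ t + p * p
    lin = solve 2 (λ p X →
        p :* (p :+ (X :+ con 1ℚ)) :+ X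
        := ((X :+ con 1ℚ) :* p :+ X) :+ p :* p) refl p X

    quad : t * t + k * X ≡ X * (d * d) + k * (p * p)
    quad = solve 2 (λ p X →
        let c = X :+ con 1ℚ
            d = p :+ c
            k = X :* X :+ c
            t = c :* p :+ X
        in t :* t :+ k :* X := X :* (d :* d) :+ k :* (p :* p)) refl p X

    p<m : p * p < X → p < m
    p<m pp<X = *-cancelʳ-<-nonNeg d
      (subst (p * d <_) (sym m*d) (cancel-< lin pp<X))

    m<p : X < p * p → m < p
    m<p X<pp = *-cancelʳ-<-nonNeg d
      (subst (_< p * d) (sym m*d) (cancel-< (sym lin) X<pp))

    mm<X : p * p < X → m * m < X
    mm<X pp<X = *-cancelʳ-<-nonNeg (d * d)
      (subst (_< X * (d * d)) (sym mm*dd)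
        (cancel-< quad (*-monoʳ-<-pos k pp<X)))

    X<mm : X < p * p → X < m * m
    X<mm X<pp = *-cancelʳ-<-nonNeg (d * d)
      (subst (X * (d * d) <_) (sym mm*dd)
        (cancel-< (sym quad) (*-monoʳ-<-pos k X<pp)))

    0<m : 0ℚ < p → 0ℚ < m
    0<m 0<p = positive⁻¹ m
      {{pos*pos⇒pos t {{pos+nonNeg⇒pos (c * p)
          {{pos*pos⇒pos c p {{positive 0<p}}}} X}}
        (1/ d) {{1/pos⇒pos d}}}}

-- p < √ X iff p < 0 or p² < X; √ X < q iff 0 < q and X < q².
√_ : (X : ℚ) .{{_ : NonNegative X}} → ℝ
√ X = record
  { L         = Low
  ; U         = Upp
  ; inhabited = (- 1ℚ , inj₁ -1<0) , (X + 1ℚ , 0<X+1 , X<[X+1]²)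
  ; L-down    = down
  ; L-open    = openL
  ; U-up      = λ { p<q (0<p , X<pp) →
                  <-trans 0<p p<q , <-trans X<pp (sq-mono-< (<⇒≤ 0<p) p<q) }
  ; U-open    = λ { {q} (0<q , X<qq) →
                  let open Between X q 0≤X (<⇒≤ 0<q) in
                  m , m<p X<qq , 0<m 0<q , X<mm X<qq }
  ; disjoint  = λ { (inj₁ q<0)  (0<q , _)    → <-asym q<0 0<q
                  ; (inj₂ qq<X) (_   , X<qq) → <-asym qq<X X<qq }
  ; located   = loc
  }
  where
  Low Upp : ℚ → Set
  Low p = p < 0ℚ ⊎ p * p < X
  Upp q = 0ℚ < q × X < q * q

  0≤X : 0ℚ ≤ X
  0≤X = nonNegative⁻¹ X

  0<X+1 : 0ℚ < X + 1ℚ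
  0<X+1 = ≤-<-trans 0≤X (p<p+1 X)

  X<[X+1]² : X < (X + 1ℚ) * (X + 1ℚ)
  X<[X+1]² = <-≤-trans (p<p+1 X)
    (subst (_≤ (X + 1ℚ) * (X + 1ℚ)) (*-identityʳ (X + 1ℚ))
      (*-monoˡ-≤-nonNeg (X + 1ℚ) {{nonNegative (<⇒≤ 0<X+1)}}
        (subst (_≤ X + 1ℚ) (+-identityˡ 1ℚ) (+-monoˡ-≤ 1ℚ 0≤X))))

  down : ∀ {p q} → p < q → Low q → Low p
  down p<q (inj₁ q<0) = inj₁ (<-trans p<q q<0)
  down {p} p<q (inj₂ qq<X) with p <? 0ℚ
  ... | yes p<0 = inj₁ p<0
  ... | no  p≮0 = inj₂ (<-trans (sq-mono-< (≮⇒≥ p≮0) p<q) qq<X)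

  openL : ∀ {p} → Low p → ∃[ q ] p < q × Low q
  openL (inj₁ p<0) = let m , p<m , m<0 = <-dense p<0 in m , p<m , inj₁ m<0
  openL {p} (inj₂ pp<X) with p <? 0ℚ
  ... | yes p<0 = openL (inj₁ p<0)
  ... | no  p≮0 = let open Between X p 0≤X (≮⇒≥ p≮0) in
                  m , p<m pp<X , inj₂ (mm<X pp<X)

  loc : ∀ {p q} → p < q → Low p ⊎ Upp q
  loc {p} {q} p<q with p <? 0ℚ | p * p <? X
  ... | yes p<0 | _        = inj₁ (inj₁ p<0)
  ... | no  _   | yes pp<X = inj₁ (inj₂ pp<X)
  ... | no  p≮0 | no  pp≮X = inj₂
    ( ≤-<-trans (≮⇒≥ p≮0) p<q
    , ≤-<-trans (≮⇒≥ pp≮X) (sq-mono-< (≮⇒≥ p≮0) p<q) )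

fromℕ : ℕ → ℚ
fromℕ k = + k / 1

radicand : ℚ → ℚ → ℚ → ℚ
radicand a₁ a₂ a₃ =
    + 1 / 3 * (a₁ + a₂ + a₃) * (a₁ + a₂ + a₃ + + 2 / 1 * a₁ * a₂ * a₃)
  + + 8 / 3 * (a₁ * a₂ + a₂ * a₃ + a₃ * a₁)

0≤fromℕ : ∀ k → 0ℚ ≤ fromℕ k
0≤fromℕ k = nonNegative⁻¹ (fromℕ k) {{normalize-nonNeg k 1}}

0≤radicand : ∀ {x y z} → 0ℚ ≤ x → 0ℚ ≤ y → 0ℚ ≤ z → 0ℚ ≤ radicand x y z
0≤radicand {x} {y} {z} hx hy hz =
  (nonNegative⁻¹ (+ 1 / 3) ⊗ s ⊗ (s ⊕ nonNegative⁻¹ (+ 2 / 1) ⊗ hx ⊗ hy ⊗ hz))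
  ⊕ (nonNegative⁻¹ (+ 8 / 3) ⊗ (hx ⊗ hy ⊕ hy ⊗ hz ⊕ hz ⊗ hx))
  where
  infixl 6 _⊕_
  infixl 7 _⊗_
  _⊕_ : ∀ {p q} → 0ℚ ≤ p → 0ℚ ≤ q → 0ℚ ≤ p + q
  _⊕_ = +-mono-≤
  _⊗_ : ∀ {p q} → 0ℚ ≤ p → 0ℚ ≤ q → 0ℚ ≤ p * q
  _⊗_ {p} {q} hp hq = nonNegative⁻¹ (p * q)
    {{nonNeg*nonNeg⇒nonNeg p {{nonNegative hp}} q {{nonNegative hq}}}}
  s : 0ℚ ≤ x + y + z
  s = hx ⊕ hy ⊕ hz

bound : ℕ → ℕ → ℕ → ℝ
bound k₁ k₂ k₃ = ½ *ʳ (√ (radicand a₁ a₂ a₃) -ʳ a₁ -ʳ a₂ -ʳ a₃)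
  where
  a₁ a₂ a₃ : ℚ
  a₁ = fromℕ k₁
  a₂ = fromℕ k₂
  a₃ = fromℕ k₃
  instance
    radicand-nonNeg : NonNegative (radicand a₁ a₂ a₃)
    radicand-nonNeg = nonNegative (0≤radicand (0≤fromℕ k₁) (0≤fromℕ k₂) (0≤fromℕ k₃))

{-# OPTIONS --safe #-}
module Submission where

-- Write a ≤ b ≤ c for the three smallest generators and let m ≥ 0 be not
-- representable by them.  If b x + c y ≡ m (mod a) with x, y ≥ 0, then
-- m + a ≤ b x + c y.  Taking y = 0 and x < a gives m ≤ a b − a − b, which is
-- strong enough when c ≥ a + b.  If c < a + b, then by coprimality c ≡ u b (mod a)
-- with 1 < u < a, and every residue i mod a is x + y u with x + y ≤ a / 2; hence
-- 2 (m + a) ≤ a c.  Either way the claim becomes a polynomial inequality in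
-- a, b, c.

open import Defs
open import Data.Nat.Base using (ℕ; _<_) renaming (_≤_ to _≤ⁿ_)
open import Data.Nat.GCD using (gcd)
open import Data.Integer.Base using (ℤ)
open import Data.Fin.Base using (Fin; inject≤; _≤_)
open import Data.Fin.Patterns using (0F; 1F; 2F)
open import Data.Vec.Functional using (Vector)
open import Relation.Binary.PropositionalEquality using (_≡_; _≢_)

open import Data.Empty using (⊥-elim)
open import Data.Fin.Base using (suc)
import Data.Integer.Base as ℤ
import Data.Integer.DivMod as ℤ
import Data.Integer.Properties as ℤ
import Algebra.Properties.AbelianGroup ℤ.+-0-abelianGroup as ℤ-Group
import Data.Integer.Tactic.RingSolver as ℤ-Ring
open import Data.Nat.Base using (suc; zero; _+_; _*_; NonZero; >-nonZero; z≤n; s≤s)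
import Data.Nat.Coprimality as Coprime
open import Data.Nat.Divisibility as Div using (_∣_)
import Data.Nat.DivMod as ℕ
import Data.Nat.GCD as GCD
import Data.Nat.Properties as ℕ
open import Data.Nat.Solver using (module +-*-Solver)
import Data.Nat.Tactic.RingSolver as ℕ-Ring
open import Algebra.Properties.Monoid.Sum ℕ.+-0-monoid using (sum; sum-cong-≗; sum-replicate-zero)
open import Data.Product.Base using (∃-syntax; _×_; _,_)
open import Data.Rational.Base as ℚ using (0ℚ)
import Data.Rational.Properties as ℚ
import Data.Rational.Solver as ℚ
import Data.Rational.Unnormalised.Base as ℚᵘ
import Data.Rational.Unnormalised.Properties as ℚᵘ
open import Data.Sum.Base using (inj₁; inj₂)
open import Relation.Binary.PropositionalEquality
  using (refl; sym; trans; cong; cong₂; subst; subst₂; module ≡-Reasoning)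
open import Relation.Nullary using (¬_; yes; no)

-- Bézout coefficients and residues modulo a

module _ {a b : ℕ} (gcd≡1 : gcd a b ≡ 1) where

  inverse : ∃[ p ] ∃[ q ] p ℤ.* ℤ.+ a ℤ.+ q ℤ.* ℤ.+ b ≡ ℤ.1ℤ
  inverse with Coprime.coprime-Bézout (Coprime.gcd≡1⇒coprime gcd≡1)
  ... | GCD.Bézout.+- x y 1+yb≡xa = ℤ.+ x , ℤ.- ℤ.+ y , trans
        (cong₂ ℤ._+_ (sym (ℤ.pos-* x a)) (sym (ℤ.neg-distribˡ-* (ℤ.+ y) (ℤ.+ b))))
        (trans (cong₂ ℤ._-_ (cong ℤ.+_ (sym 1+yb≡xa)) (sym (ℤ.pos-* y b)))
        (ℤ-cancel ℤ.1ℤ (ℤ.+ (y * b))))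
    where
    ℤ-cancel : ∀ i j → i ℤ.+ j ℤ.- j ≡ i
    ℤ-cancel = ℤ-Ring.solve-∀
  ... | GCD.Bézout.-+ x y 1+xa≡yb = ℤ.- ℤ.+ x , ℤ.+ y , trans
        (cong₂ ℤ._+_ (sym (ℤ.neg-distribˡ-* (ℤ.+ x) (ℤ.+ a))) (sym (ℤ.pos-* y b)))
        (trans (cong₂ (λ i j → ℤ.- i ℤ.+ j) (sym (ℤ.pos-* x a)) (cong ℤ.+_ (sym 1+xa≡yb)))
        (ℤ-cancel ℤ.1ℤ (ℤ.+ (x * a))))
    where
    ℤ-cancel : ∀ i j → ℤ.- j ℤ.+ (i ℤ.+ j) ≡ i
    ℤ-cancel = ℤ-Ring.solve-∀

  -- Multiplying p a + q b = 1 by m gives m ≡ (m q) b (mod a). Reducing m q modulo a brings the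
  -- coefficient of b below a; everything else is collected in k, which may be negative.
  residue : .{{_ : NonZero a}} → ∀ m →
    ∃[ i ] ∃[ k ] i < a × m ≡ ℤ.+ i ℤ.* ℤ.+ b ℤ.+ k ℤ.* ℤ.+ a
  residue m =
    let p , q , pa+qb≡1 = inverse
        i = (m ℤ.* q) ℤ.%ℕ a
        h = (m ℤ.* q) ℤ./ℕ a
        regroup : ∀ m p q a b → m ℤ.* (p ℤ.* a ℤ.+ q ℤ.* b) ≡ m ℤ.* p ℤ.* a ℤ.+ (m ℤ.* q) ℤ.* b
        regroup = ℤ-Ring.solve-∀
        collect : ∀ m p i h a b → m ℤ.* p ℤ.* a ℤ.+ (i ℤ.+ h ℤ.* a) ℤ.* b
                ≡ i ℤ.* b ℤ.+ (m ℤ.* p ℤ.+ h ℤ.* b) ℤ.* a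
        collect = ℤ-Ring.solve-∀
    in i , m ℤ.* p ℤ.+ h ℤ.* ℤ.+ b , ℤ.n%ℕd<d (m ℤ.* q) a ,
       trans (sym (ℤ.*-identityʳ m))
       (trans (cong (m ℤ.*_) (sym pa+qb≡1))
       (trans (regroup m p q (ℤ.+ a) (ℤ.+ b))
       (trans (cong (λ j → m ℤ.* p ℤ.* ℤ.+ a ℤ.+ j ℤ.* ℤ.+ b) (ℤ.a≡a%ℕn+[a/ℕn]*n (m ℤ.* q) a))
              (collect m p (ℤ.+ i) h (ℤ.+ a) (ℤ.+ b)))))

-- Polynomial inequalities

-- Three times `radicand`: the factor clears the thirds, so that squares can be compared in ℕ.
tripleRadicand : ℕ → ℕ → ℕ → ℕ
tripleRadicand a b c =
  (a + b + c) * (a + b + c + 2 * a * b * c) + 8 * (a * b + b * c + c * a)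

module _ where
  open +-*-Solver

  private
    tripleRadicandᴾ : ∀ {n} → (a b c : Polynomial n) → Polynomial n
    tripleRadicandᴾ a b c =
      (a :+ b :+ c) :* (a :+ b :+ c :+ con 2 :* a :* b :* c)
      :+ con 8 :* (a :* b :+ b :* c :+ c :* a)

    ≤-by : ∀ {m n d} → m + d ≡ n → m ≤ⁿ n
    ≤-by {m} {d = d} m+d≡n = subst (m ≤ⁿ_) m+d≡n (ℕ.m≤m+n m d)

  -- In each of the next three lemmas the variables are chosen so that the
  -- difference of the two sides has only nonnegative coefficients.
  sum²≤ : ∀ x y z → let a = 1 + x; b = 1 + y; c = 1 + z; s = a + b + c in
    3 * (s * s) ≤ⁿ tripleRadicand a b c
  sum²≤ x y z = ≤-by (solve 3 (λ x y z →
    let a = con 1 :+ x; b = con 1 :+ y; c = con 1 :+ z; s = a :+ b :+ c in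
    con 3 :* (s :* s) :+
    ( con 2 :* x :* x :* (y :* z :+ y :+ z)
    :+ con 2 :* y :* y :* (z :* x :+ z :+ x)
    :+ con 2 :* z :* z :* (x :* y :+ x :+ y)
    :+ con 12 :* x :* y :* z :+ con 14 :* (x :* y :+ y :* z :+ z :* x)
    :+ con 12 :* (x :+ y :+ z) :+ con 12)
    := tripleRadicandᴾ a b c) refl x y z)

  twoGenerator²≤ : ∀ x f d →
    let a = 1 + x; b = a + f; c = a + b + d; w = 2 * (a * b) + d in
    3 * (w * w) ≤ⁿ tripleRadicand a b c
  twoGenerator²≤ x f d = ≤-by (solve 3 (λ x f d →
    let a = con 1 :+ x; b = a :+ f; c = a :+ b :+ d; w = con 2 :* (a :* b) :+ d in
    con 3 :* (w :* w) :+
    ( con 4 :* x :* x :* x :* x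
    :+ (con 8 :* f :+ con 12 :* d :+ con 16) :* x :* x :* x
    :+ ((con 8 :* f :+ con 18 :* d :+ con 24) :* f :+ (con 2 :* d :+ con 24) :* d :+ con 80) :* x :* x
    :+ (((con 4 :* f :+ con 6 :* d :+ con 16) :* f :+ (con 2 :* d :+ con 24) :* d :+ con 80) :* f
      :+ (con 4 :* d :+ con 36) :* d :+ con 128) :* x
    :+ ((con 4 :* f :+ con 6 :* d :+ con 20) :* f :+ (con 2 :* d :+ con 18) :* d :+ con 64) :* f :+ con 24 :* d :+ con 60)
    := tripleRadicandᴾ a b c) refl x f d)

  threeGenerator²≤ : ∀ e f g →
    let a = 2 + e + g; b = a + f; c = b + (1 + e); w = a * c + f + c in
    3 * (w * w) ≤ⁿ tripleRadicand a b c
  threeGenerator²≤ e f g = ≤-by (solve 3 (λ e f g →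
    let a = con 2 :+ e :+ g; b = a :+ f; c = b :+ (con 1 :+ e); w = a :* c :+ f :+ c in
    con 3 :* (w :* w) :+
    ( con 4 :* e :* e :* e :* e
    :+ (con 20 :* f :+ con 16 :* g :+ con 8) :* e :* e :* e
    :+ ((con 17 :* f :+ con 48 :* g :+ con 72) :* f :+ (con 23 :* g :+ con 46) :* g :+ con 19) :* e :* e
    :+ (((con 4 :* f :+ con 28 :* g :+ con 50) :* f :+ (con 38 :* g :+ con 118) :* g :+ con 100) :* f
      :+ ((con 14 :* g :+ con 58) :* g :+ con 102) :* g :+ con 90) :* e
    :+ (((con 4 :* g :+ con 8) :* f :+ (con 11 :* g :+ con 38) :* g :+ con 32) :* f
      :+ ((con 10 :* g :+ con 50) :* g :+ con 96) :* g :+ con 72) :* f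
      :+ (((con 3 :* g :+ con 20) :* g :+ con 65) :* g :+ con 126) :* g :+ con 102)
    := tripleRadicandᴾ a b c) refl e f g)

-- Short representations of residues by steps 1 and u

module _ {a i : ℕ} (i<a : i < a) where
  open ℕ.≤-Reasoning

  -- When c ≡ u b (mod a), adding b is a step of length 1 and adding c a step of length u around
  -- ℤ/a. Then x + y counts the steps from 0 to i, and h the full turns made on the way.
  ShortRepresentation : ℕ → Set
  ShortRepresentation u =
    ∃[ x ] ∃[ y ] ∃[ h ] 2 * (x + y) ≤ⁿ a × i + h * a ≡ x + y * u

  -- Division of i by u needs no full turn. If q = 0, the remainder is below u, hence at most a / 2;
  -- otherwise `suc r` ≤ u and 2 ≤ u bound 2 (r + q) by i + 1 ≤ a.
  forward : ∀ u .{{_ : NonZero u}} → 1 < u → 2 * u ≤ⁿ a → ShortRepresentation u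
  forward u 1<u 2u≤a =
    r , q , 0 , short q i≡r+qu , trans (ℕ.+-identityʳ i) i≡r+qu
    where
    r = i ℕ.% u
    q = i ℕ./ u
    i≡r+qu : i ≡ r + q * u
    i≡r+qu = ℕ.m≡m%n+[m/n]*n i u
    split : ∀ r q → 2 * (r + suc q) ≡ suc r + (r + suc (2 * q))
    split = ℕ-Ring.solve-∀
    collect : ∀ u r p → u + (r + suc p) ≡ suc (r + (u + p))
    collect = ℕ-Ring.solve-∀
    short : ∀ q → i ≡ r + q * u → 2 * (r + q) ≤ⁿ a
    short zero    _      = begin
      2 * (r + 0)               ≡⟨ cong (2 *_) (ℕ.+-identityʳ r) ⟩
      2 * r                     ≤⟨ ℕ.*-monoʳ-≤ 2 (ℕ.<⇒≤ (ℕ.m%n<n i u)) ⟩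
      2 * u                     ≤⟨ 2u≤a ⟩
      a                         ∎
    short (suc q) i≡r+qu = begin
      2 * (r + suc q)           ≡⟨ split r q ⟩
      suc r + (r + suc (2 * q)) ≤⟨ ℕ.+-mono-≤ (ℕ.m%n<n i u)
                                     (ℕ.+-monoʳ-≤ r (s≤s (ℕ.*-monoˡ-≤ q 1<u))) ⟩
      u + (r + suc (u * q))     ≡⟨ cong (λ p → u + (r + suc p)) (ℕ.*-comm u q) ⟩
      u + (r + suc (q * u))     ≡⟨ collect u r (q * u) ⟩
      suc (r + suc q * u)       ≡⟨ cong suc i≡r+qu ⟨
      suc i                     ≤⟨ i<a ⟩
      a                         ∎

  -- A step u is a step back by v modulo a. A residue in the lower half is reached by unit steps
  -- alone, one in the upper half by going backwards from a.
  backward : ∀ {u} v .{{_ : NonZero v}} → u + v ≡ a → 2 * v ≤ⁿ a → ShortRepresentation u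
  backward {u} v u+v≡a 2v≤a with 2 * i ℕ.≤? a
  ... | yes 2i≤a = i , 0 , 0 , subst (λ k → 2 * k ≤ⁿ a) (sym (ℕ.+-identityʳ i)) 2i≤a , refl
  -- The distance from i up to a is `suc j`. The fewest steps back that cover it number `suc q`, and
  -- s unit steps undo the overshoot. Each step u = a - v falls short of a turn by v, which leaves q
  -- full turns.
  ... | no  2i≰a with j , 1+i+j≡a ← ℕ.m≤n⇒∃[o]m+o≡n i<a
                 with s , 1+r+s≡v ← ℕ.m≤n⇒∃[o]m+o≡n (ℕ.m%n<n j v) =
    s , suc q , q , short q j≡r+qv , ℕ.+-cancelʳ-≡ (suc j) _ _ shift
    where
    r = j ℕ.% v
    q = j ℕ./ v
    j≡r+qv : j ≡ r + q * v
    j≡r+qv = ℕ.m≡m%n+[m/n]*n j v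
    s<v : s < v
    s<v = subst (s <_) 1+r+s≡v (s≤s (ℕ.m≤n+m s r))
    2j<a : 2 * suc j ≤ⁿ a
    2j<a = ℕ.+-cancelˡ-≤ (2 * i) _ _ (begin
      2 * i + 2 * suc j         ≡⟨ double i j ⟩
      2 * (suc i + j)           ≡⟨ cong (2 *_) 1+i+j≡a ⟩
      2 * a                     ≡⟨ cong (a +_) (ℕ.+-identityʳ a) ⟩
      a + a                     ≤⟨ ℕ.+-monoˡ-≤ a (ℕ.<⇒≤ (ℕ.≰⇒> 2i≰a)) ⟩
      2 * i + a                 ∎)
      where
      double : ∀ i j → 2 * i + 2 * suc j ≡ 2 * (suc i + j)
      double = ℕ-Ring.solve-∀
    short : ∀ q → j ≡ r + q * v → 2 * (s + suc q) ≤ⁿ a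
    short zero    _      = begin
      2 * (s + 1)               ≡⟨ cong (2 *_) (ℕ.+-comm s 1) ⟩
      2 * suc s                 ≤⟨ ℕ.*-monoʳ-≤ 2 s<v ⟩
      2 * v                     ≤⟨ 2v≤a ⟩
      a                         ∎
    -- `suc s` fits into one stretch of length v, and every other step back is at least 1 long, so
    -- the count is at most `suc j`, which is at most half of a.
    short (suc q) j≡r+qv = begin
      2 * (s + suc (suc q))     ≤⟨ ℕ.*-monoʳ-≤ 2 (begin
        s + suc (suc q)           ≡⟨ ℕ.+-suc s (suc q) ⟩
        suc s + suc q             ≤⟨ ℕ.+-mono-≤ s<v (s≤s (ℕ.m≤m*n q v)) ⟩
        v + suc (q * v)           ≡⟨ ℕ.+-suc v (q * v) ⟩
        suc (suc q * v)           ≤⟨ s≤s (ℕ.m≤n+m (suc q * v) r) ⟩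
        suc (r + suc q * v)       ≡⟨ cong suc j≡r+qv ⟨
        suc j                     ∎) ⟩
      2 * suc j                 ≤⟨ 2j<a ⟩
      a                         ∎
    shift : i + q * a + suc j ≡ s + suc q * u + suc j
    shift = begin-equality
      i + q * a + suc j              ≡⟨ rearrange₁ i q a j ⟩
      (suc i + j) + q * a            ≡⟨ cong (_+ q * a) 1+i+j≡a ⟩
      suc q * a                      ≡⟨ cong (suc q *_) u+v≡a ⟨
      suc q * (u + v)                ≡⟨ rearrange₂ q u v ⟩
      v + (suc q * u + q * v)        ≡⟨ cong (_+ (suc q * u + q * v)) 1+r+s≡v ⟨
      (suc r + s) + (suc q * u + q * v) ≡⟨ rearrange₃ r s (suc q * u) (q * v) ⟩
      s + suc q * u + suc (r + q * v) ≡⟨ cong (λ k → s + suc q * u + suc k) j≡r+qv ⟨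
      s + suc q * u + suc j          ∎
      where
      rearrange₁ : ∀ i q a j → i + q * a + suc j ≡ (suc i + j) + q * a
      rearrange₁ = ℕ-Ring.solve-∀
      rearrange₂ : ∀ q u v → suc q * (u + v) ≡ v + (suc q * u + q * v)
      rearrange₂ = ℕ-Ring.solve-∀
      rearrange₃ : ∀ r s m n → (suc r + s) + (m + n) ≡ s + m + suc (r + n)
      rearrange₃ = ℕ-Ring.solve-∀

  -- The step u is used forwards or backwards around ℤ/a, whichever is shorter.
  short-representation : ∀ {u} → 1 < u → u < a → ShortRepresentation u
  short-representation {u} 1<u u<a with 2 * u ℕ.≤? a | ℕ.m≤n⇒∃[o]m+o≡n u<a
  ... | yes 2u≤a | _              = forward u {{>-nonZero (ℕ.<-trans (s≤s z≤n) 1<u)}} 1<u 2u≤a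
  ... | no  2u≰a | v , 1+u+v≡a    = backward (suc v) u+v≡a (begin
      2 * suc v                 ≡⟨ cong (suc v +_) (ℕ.+-identityʳ (suc v)) ⟩
      suc v + suc v             ≤⟨ ℕ.+-monoˡ-≤ (suc v) v≤u ⟩
      u + suc v                 ≡⟨ u+v≡a ⟩
      a                         ∎)
    where
    u+v≡a : u + suc v ≡ a
    u+v≡a = trans (ℕ.+-suc u v) 1+u+v≡a
    v≤u : suc v ≤ⁿ u
    v≤u = ℕ.+-cancelˡ-≤ u _ _ (begin
      u + suc v                 ≡⟨ u+v≡a ⟩
      a                         ≤⟨ ℕ.<⇒≤ (ℕ.≰⇒> 2u≰a) ⟩
      2 * u                     ≡⟨ cong (u +_) (ℕ.+-identityʳ u) ⟩
      u + u                     ∎)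

-- Congruences modulo a and bounds for unrepresentable numbers

Representable₃ : (a b c : ℕ) → ℕ → Set
Representable₃ a b c m = ∃[ x ] ∃[ y ] ∃[ z ] m ≡ x * a + y * b + z * c

module _ {a b c : ℕ} where

  private
    divides : ∀ {n} k → ℤ.+ n ≡ k ℤ.* ℤ.+ a → a ∣ n
    divides k n≡ka = Div.divides ℤ.∣ k ∣ (trans (cong ℤ.∣_∣ n≡ka) (ℤ.abs-* k (ℤ.+ a)))

  -- u = 0 would make a > 1 divide c, against coprimality; u = 1 would make a divide c - b, which
  -- lies strictly between 0 and a.
  multiplier>1 : gcd a c ≡ 1 → 1 < a → b < c → c < b + a →
    ∀ u k → ℤ.+ c ≡ ℤ.+ u ℤ.* ℤ.+ b ℤ.+ k ℤ.* ℤ.+ a → 1 < u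
  multiplier>1 gcd[a,c]≡1 1<a _ _ 0 k c≡ = ⊥-elim (ℕ.<-irrefl (sym (Coprime.gcd≡1⇒coprime gcd[a,c]≡1
    (Div.∣-refl , divides k (trans c≡ (ℤ.+-identityˡ _))))) 1<a)
  multiplier>1 _ _ b<c c<b+a 1 k c≡ with e , b+1+e≡c ← ℕ.m≤n⇒∃[o]m+o≡n b<c =
    ⊥-elim (ℕ.<⇒≱ 1+e<a (Div.∣⇒≤ (divides k 1+e≡ka)))
    where
    b+[1+e]≡c : b + suc e ≡ c
    b+[1+e]≡c = trans (ℕ.+-suc b e) b+1+e≡c
    1+e<a : suc e < a
    1+e<a = ℕ.+-cancelˡ-< b _ _ (subst (_< b + a) (sym b+[1+e]≡c) c<b+a)
    1+e≡ka : ℤ.+ suc e ≡ k ℤ.* ℤ.+ a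
    1+e≡ka = ℤ-Group.∙-cancelˡ (ℤ.+ b) _ _
      (trans (cong ℤ.+_ b+[1+e]≡c) (trans c≡ (cong (ℤ._+ k ℤ.* ℤ.+ a) (ℤ.*-identityˡ (ℤ.+ b)))))
  multiplier>1 _ _ _ _ (suc (suc u)) _ _ = s≤s (s≤s z≤n)

  -- Modulo a, m ≡ i b ≡ (x + y u) b ≡ x b + y c. The multiple of a is kept as an explicit integer
  -- because `gap` argues by its sign.
  combination : ∀ m i u x y h k l →
    ℤ.+ c ≡ ℤ.+ u ℤ.* ℤ.+ b ℤ.+ k ℤ.* ℤ.+ a →
    ℤ.+ m ≡ ℤ.+ i ℤ.* ℤ.+ b ℤ.+ l ℤ.* ℤ.+ a →
    i + h * a ≡ x + y * u →
    ∃[ g ] ℤ.+ m ≡ ℤ.+ x ℤ.* ℤ.+ b ℤ.+ ℤ.+ y ℤ.* ℤ.+ c ℤ.+ g ℤ.* ℤ.+ a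
  combination m i u x y h k l c≡ m≡ i+ha≡x+yu = n ℤ.- ℤ.+ y ℤ.* k , eq
    where
    open ≡-Reasoning
    pull-out : ∀ i h l a b → i ℤ.* b ℤ.+ l ℤ.* a ≡ (i ℤ.+ h ℤ.* a) ℤ.* b ℤ.+ (l ℤ.- h ℤ.* b) ℤ.* a
    pull-out = ℤ-Ring.solve-∀
    expand : ∀ x y u k n a b → (x ℤ.+ y ℤ.* u) ℤ.* b ℤ.+ n ℤ.* a
           ≡ x ℤ.* b ℤ.+ y ℤ.* (u ℤ.* b ℤ.+ k ℤ.* a) ℤ.+ (n ℤ.- y ℤ.* k) ℤ.* a
    expand = ℤ-Ring.solve-∀
    i+ha≡x+yu′ : ℤ.+ i ℤ.+ ℤ.+ h ℤ.* ℤ.+ a ≡ ℤ.+ x ℤ.+ ℤ.+ y ℤ.* ℤ.+ u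
    i+ha≡x+yu′ = trans (cong (ℤ._+_ (ℤ.+ i)) (sym (ℤ.pos-* h a)))
      (trans (cong ℤ.+_ i+ha≡x+yu) (cong (ℤ._+_ (ℤ.+ x)) (ℤ.pos-* y u)))
    n = l ℤ.- ℤ.+ h ℤ.* ℤ.+ b
    eq : ℤ.+ m ≡ ℤ.+ x ℤ.* ℤ.+ b ℤ.+ ℤ.+ y ℤ.* ℤ.+ c ℤ.+ (n ℤ.- ℤ.+ y ℤ.* k) ℤ.* ℤ.+ a
    eq = begin
      ℤ.+ m
        ≡⟨ m≡ ⟩
      ℤ.+ i ℤ.* ℤ.+ b ℤ.+ l ℤ.* ℤ.+ a
        ≡⟨ pull-out (ℤ.+ i) (ℤ.+ h) l (ℤ.+ a) (ℤ.+ b) ⟩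
      (ℤ.+ i ℤ.+ ℤ.+ h ℤ.* ℤ.+ a) ℤ.* ℤ.+ b ℤ.+ n ℤ.* ℤ.+ a
        ≡⟨ cong (λ j → j ℤ.* ℤ.+ b ℤ.+ n ℤ.* ℤ.+ a) i+ha≡x+yu′ ⟩
      (ℤ.+ x ℤ.+ ℤ.+ y ℤ.* ℤ.+ u) ℤ.* ℤ.+ b ℤ.+ n ℤ.* ℤ.+ a
        ≡⟨ expand (ℤ.+ x) (ℤ.+ y) (ℤ.+ u) k n (ℤ.+ a) (ℤ.+ b) ⟩
      ℤ.+ x ℤ.* ℤ.+ b ℤ.+ ℤ.+ y ℤ.* (ℤ.+ u ℤ.* ℤ.+ b ℤ.+ k ℤ.* ℤ.+ a) ℤ.+ (n ℤ.- ℤ.+ y ℤ.* k) ℤ.* ℤ.+ a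
        ≡⟨ cong (λ j → ℤ.+ x ℤ.* ℤ.+ b ℤ.+ ℤ.+ y ℤ.* j ℤ.+ (n ℤ.- ℤ.+ y ℤ.* k) ℤ.* ℤ.+ a) c≡ ⟨
      ℤ.+ x ℤ.* ℤ.+ b ℤ.+ ℤ.+ y ℤ.* ℤ.+ c ℤ.+ (n ℤ.- ℤ.+ y ℤ.* k) ℤ.* ℤ.+ a
        ∎

module _ {a b c m : ℕ} (¬rep : ¬ Representable₃ a b c m) where

  -- A nonnegative h would itself represent m. So h ≤ -1, and moving h a to the other side adds at
  -- least a to m.
  gap : ∀ x y h → ℤ.+ m ≡ ℤ.+ x ℤ.* ℤ.+ b ℤ.+ ℤ.+ y ℤ.* ℤ.+ c ℤ.+ h ℤ.* ℤ.+ a →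
    m + a ≤ⁿ x * b + y * c
  gap x y (ℤ.+ z) m≡ = ⊥-elim (¬rep (z , x , y , ℤ.+-injective (begin
    ℤ.+ m                                   ≡⟨ m≡ ⟩
    ℤ.+ x ℤ.* ℤ.+ b ℤ.+ ℤ.+ y ℤ.* ℤ.+ c ℤ.+ ℤ.+ z ℤ.* ℤ.+ a
      ≡⟨ cong₂ ℤ._+_ (cong₂ ℤ._+_ (ℤ.pos-* x b) (ℤ.pos-* y c)) (ℤ.pos-* z a) ⟨
    ℤ.+ (x * b + y * c + z * a)             ≡⟨ cong ℤ.+_ (rotate (x * b) (y * c) (z * a)) ⟩
    ℤ.+ (z * a + x * b + y * c)             ∎)))
    where
    open ≡-Reasoning
    rotate : ∀ i j k → i + j + k ≡ k + i + j
    rotate = ℕ-Ring.solve-∀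
  gap x y h@(ℤ.-[1+ z ]) m≡ =
    subst (m + a ≤ⁿ_) (ℤ.+-injective eq) (ℕ.+-monoʳ-≤ m (ℕ.m≤m+n a (z * a)))
    where
    open ≡-Reasoning
    cancel : ∀ i k a → i ℤ.+ ℤ.- k ℤ.* a ℤ.+ k ℤ.* a ≡ i
    cancel = ℤ-Ring.solve-∀
    eq : ℤ.+ (m + suc z * a) ≡ ℤ.+ (x * b + y * c)
    eq = begin
      ℤ.+ m ℤ.+ ℤ.+ (suc z * a)             ≡⟨ cong₂ ℤ._+_ m≡ (ℤ.pos-* (suc z) a) ⟩
      ℤ.+ x ℤ.* ℤ.+ b ℤ.+ ℤ.+ y ℤ.* ℤ.+ c ℤ.+ h ℤ.* ℤ.+ a ℤ.+ ℤ.+ suc z ℤ.* ℤ.+ a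
        ≡⟨ cancel (ℤ.+ x ℤ.* ℤ.+ b ℤ.+ ℤ.+ y ℤ.* ℤ.+ c) (ℤ.+ suc z) (ℤ.+ a) ⟩
      ℤ.+ x ℤ.* ℤ.+ b ℤ.+ ℤ.+ y ℤ.* ℤ.+ c   ≡⟨ cong₂ ℤ._+_ (ℤ.pos-* x b) (ℤ.pos-* y c) ⟨
      ℤ.+ (x * b + y * c)                   ∎

  -- Sylvester's bound for two generators in additive form: the extra b is absorbed because i ≤ a -
  -- 1.
  twoGenerator-bound : .{{_ : NonZero a}} → gcd a b ≡ 1 → m + a + b ≤ⁿ a * b
  twoGenerator-bound gcd≡1 =
    let i , k , i<a , m≡ib+ka = residue gcd≡1 (ℤ.+ m) in begin
    m + a + b           ≤⟨ ℕ.+-monoˡ-≤ b (gap i 0 k (trans m≡ib+ka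
                             (cong (ℤ._+ k ℤ.* ℤ.+ a) (sym (ℤ.+-identityʳ (ℤ.+ i ℤ.* ℤ.+ b)))))) ⟩
    i * b + 0 + b       ≡⟨ cong (_+ b) (ℕ.+-identityʳ (i * b)) ⟩
    i * b + b           ≡⟨ ℕ.+-comm (i * b) b ⟩
    suc i * b           ≤⟨ ℕ.*-monoˡ-≤ b i<a ⟩
    a * b               ∎
    where open ℕ.≤-Reasoning

  threeGenerator-bound : .{{_ : NonZero a}} → gcd a b ≡ 1 → gcd a c ≡ 1 →
    1 < a → b < c → c < b + a → 2 * (m + a) ≤ⁿ a * c
  threeGenerator-bound gcd[a,b]≡1 gcd[a,c]≡1 1<a b<c c<b+a =
    let u , k , u<a , c≡ub+ka = residue gcd[a,b]≡1 (ℤ.+ c)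
        i , l , i<a , m≡ib+la = residue gcd[a,b]≡1 (ℤ.+ m)
        1<u = multiplier>1 gcd[a,c]≡1 1<a b<c c<b+a u k c≡ub+ka
        x , y , h , 2[x+y]≤a , i+ha≡x+yu = short-representation i<a 1<u u<a
        g , m≡xb+yc+ga = combination m i u x y h k l c≡ub+ka m≡ib+la i+ha≡x+yu
    in begin
    2 * (m + a)           ≤⟨ ℕ.*-monoʳ-≤ 2 (gap x y g m≡xb+yc+ga) ⟩
    -- Replacing b by the larger c leaves a quantity that depends only on the count x + y.
    2 * (x * b + y * c)   ≤⟨ ℕ.*-monoʳ-≤ 2 (ℕ.+-monoˡ-≤ (y * c) (ℕ.*-monoʳ-≤ x (ℕ.<⇒≤ b<c))) ⟩
    2 * (x * c + y * c)   ≡⟨ cong (2 *_) (ℕ.*-distribʳ-+ c x y) ⟨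
    2 * ((x + y) * c)     ≡⟨ ℕ.*-assoc 2 (x + y) c ⟨
    2 * (x + y) * c       ≤⟨ ℕ.*-monoˡ-≤ c 2[x+y]≤a ⟩
    a * c                 ∎
    where open ℕ.≤-Reasoning

-- The bound over the integers, by cases on F and c

-- A square-root-free form of F ≤ ½ (√ (tripleRadicand a b c / 3) − a − b − c).
HasBound : (a b c : ℕ) → ℤ → Set
HasBound a b c F = ∃[ w ]
  F ℤ.+ F ℤ.+ ℤ.+ (a + b + c) ℤ.≤ ℤ.+ w × 3 * (w * w) ≤ⁿ tripleRadicand a b c

module _ {a b c : ℕ} (0<a : 0 < a) (a≤b : a ≤ⁿ b) (b≤c : b ≤ⁿ c)
         (gcd[a,b]≡1 : gcd a b ≡ 1) (gcd[a,c]≡1 : gcd a c ≡ 1) (gcd[b,c]≡1 : gcd b c ≡ 1) where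

  private
    instance
      a≢0 : NonZero a
      a≢0 = >-nonZero 0<a

  -- For F < 0 the term 2 F only lowers the left side, so w = a + b + c suffices.
  hasBound-negative : ∀ k → HasBound a b c ℤ.-[1+ k ]
  hasBound-negative k
    with x , refl ← ℕ.m≤n⇒∃[o]m+o≡n 0<a
       | y , refl ← ℕ.m≤n⇒∃[o]m+o≡n (ℕ.<-≤-trans 0<a a≤b)
       | z , refl ← ℕ.m≤n⇒∃[o]m+o≡n (ℕ.<-≤-trans 0<a (ℕ.≤-trans a≤b b≤c)) =
    a + b + c , ℤ.+-monoˡ-≤ (ℤ.+ (a + b + c)) (ℤ.-≤+ {suc (k + k)} {0}) , sum²≤ x y z

  module _ {m : ℕ} (¬rep : ¬ Representable₃ a b c m) where

    hasBound-large : a + b ≤ⁿ c → HasBound a b c (ℤ.+ m)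
    hasBound-large a+b≤c
      with x , refl ← ℕ.m≤n⇒∃[o]m+o≡n 0<a
      with f , refl ← ℕ.m≤n⇒∃[o]m+o≡n a≤b
      with d , refl ← ℕ.m≤n⇒∃[o]m+o≡n a+b≤c =
      -- Since c = a + b + d, the left side is 2 (m + a + b) + d, and the bracket is at most a b.
      2 * (a * b) + d , ℤ.+≤+ (begin
        m + m + (a + b + (a + b + d)) ≡⟨ regroup m a b d ⟩
        2 * (m + a + b) + d           ≤⟨ ℕ.+-monoˡ-≤ d (ℕ.*-monoʳ-≤ 2
                                           (twoGenerator-bound ¬rep gcd[a,b]≡1)) ⟩
        2 * (a * b) + d               ∎) , twoGenerator²≤ x f d
      where
      open ℕ.≤-Reasoning
      regroup : ∀ m a b d → m + m + (a + b + (a + b + d)) ≡ 2 * (m + a + b) + d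
      regroup = ℕ-Ring.solve-∀

    -- If a = 1, every natural number is a multiple of a.
    1<a : 1 < a
    1<a = ℕ.≤∧≢⇒< 0<a λ { refl → ¬rep (m , 0 , 0 , (begin
      m                     ≡⟨ ℕ.*-identityʳ m ⟨
      m * 1                 ≡⟨ ℕ.+-identityʳ (m * 1) ⟨
      m * 1 + 0             ≡⟨ ℕ.+-identityʳ (m * 1 + 0) ⟨
      m * 1 + 0 + 0         ∎)) }
      where open ≡-Reasoning

    -- If b = c, coprimality forces b = 1, against 1 < a ≤ b.
    b<c : b < c
    b<c = ℕ.≤∧≢⇒< b≤c λ { refl → ℕ.<-irrefl
      (sym (Coprime.gcd≡1⇒coprime gcd[b,c]≡1 (Div.∣-refl , Div.∣-refl)))
      (ℕ.<-≤-trans 1<a a≤b) }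

    hasBound-small : c < b + a → HasBound a b c (ℤ.+ m)
    hasBound-small c<b+a
      with f , refl ← ℕ.m≤n⇒∃[o]m+o≡n a≤b
      with e , refl ← ℕ.m≤n⇒∃[o]m+o≡n b<c
      -- g is the slack in c - b < a, that is `suc e < a`; it turns a into 2 + e + g, the form that
      -- `threeGenerator²≤` expects.
      with g , refl ← ℕ.m≤n⇒∃[o]m+o≡n (ℕ.+-cancelˡ-< b (suc e) a
                        (subst (_< b + a) (sym (ℕ.+-suc b e)) c<b+a)) =
      -- Since b = a + f, the left side is 2 (m + a) + f + c, and 2 (m + a) is at most a c.
      a * c + f + c , ℤ.+≤+ (begin
        m + m + (a + (a + f) + c)     ≡⟨ regroup m a f c ⟩
        2 * (m + a) + f + c           ≤⟨ ℕ.+-monoˡ-≤ c (ℕ.+-monoˡ-≤ f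
            (threeGenerator-bound ¬rep gcd[a,b]≡1 gcd[a,c]≡1 1<a b<c c<b+a)) ⟩
        a * c + f + c                 ∎) ,
      subst (λ c → 3 * ((a * c + f + c) * (a * c + f + c)) ≤ⁿ tripleRadicand a b c)
        (ℕ.+-suc b e) (threeGenerator²≤ e f g)
      where
      open ℕ.≤-Reasoning
      regroup : ∀ m a f c → m + m + (a + (a + f) + c) ≡ 2 * (m + a) + f + c
      regroup = ℕ-Ring.solve-∀

  hasBound : ∀ F → (∀ m → F ≡ ℤ.+ m → ¬ Representable₃ a b c m) → HasBound a b c F
  hasBound ℤ.-[1+ k ] _    = hasBound-negative k
  hasBound (ℤ.+ m)    ¬rep with a + b ℕ.≤? c
  ... | yes a+b≤c = hasBound-large (¬rep m refl) a+b≤c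
  ... | no  a+b≰c = hasBound-small (¬rep m refl)
                      (subst (c <_) (ℕ.+-comm a b) (ℕ.≰⇒> a+b≰c))

-- Embedding ℤ and ℕ into ℚ

module _ where
  open ℚᵘ.≃-Reasoning

  /1-homo-+ : ∀ i j → (i ℤ.+ j) ℚ./ 1 ≡ i ℚ./ 1 ℚ.+ j ℚ./ 1
  /1-homo-+ i j = ℚ.toℚᵘ-injective (begin
    ℚ.toℚᵘ ((i ℤ.+ j) ℚ./ 1)                     ≈⟨ ℚ.toℚᵘ-fromℚᵘ (ℚᵘ.mkℚᵘ (i ℤ.+ j) 0) ⟩
    ℚᵘ.mkℚᵘ (i ℤ.+ j) 0                          ≈⟨ ℚᵘ.*≡* (numerators i j) ⟩
    ℚᵘ.mkℚᵘ i 0 ℚᵘ.+ ℚᵘ.mkℚᵘ j 0                 ≈⟨ ℚᵘ.+-cong (ℚ.toℚᵘ-fromℚᵘ (ℚᵘ.mkℚᵘ i 0))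
                                                              (ℚ.toℚᵘ-fromℚᵘ (ℚᵘ.mkℚᵘ j 0)) ⟨
    ℚ.toℚᵘ (i ℚ./ 1) ℚᵘ.+ ℚ.toℚᵘ (j ℚ./ 1)       ≈⟨ ℚ.toℚᵘ-homo-+ (i ℚ./ 1) (j ℚ./ 1) ⟨
    ℚ.toℚᵘ (i ℚ./ 1 ℚ.+ j ℚ./ 1)                 ∎)
    where
    numerators : ∀ i j → (i ℤ.+ j) ℤ.* ℤ.1ℤ ≡ (i ℤ.* ℤ.1ℤ ℤ.+ j ℤ.* ℤ.1ℤ) ℤ.* ℤ.1ℤ
    numerators = ℤ-Ring.solve-∀

  /1-homo-* : ∀ i j → (i ℤ.* j) ℚ./ 1 ≡ (i ℚ./ 1) ℚ.* (j ℚ./ 1)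
  /1-homo-* i j = ℚ.toℚᵘ-injective (begin
    ℚ.toℚᵘ ((i ℤ.* j) ℚ./ 1)                     ≈⟨ ℚ.toℚᵘ-fromℚᵘ (ℚᵘ.mkℚᵘ (i ℤ.* j) 0) ⟩
    ℚᵘ.mkℚᵘ i 0 ℚᵘ.* ℚᵘ.mkℚᵘ j 0                 ≈⟨ ℚᵘ.*-cong (ℚ.toℚᵘ-fromℚᵘ (ℚᵘ.mkℚᵘ i 0))
                                                              (ℚ.toℚᵘ-fromℚᵘ (ℚᵘ.mkℚᵘ j 0)) ⟨
    ℚ.toℚᵘ (i ℚ./ 1) ℚᵘ.* ℚ.toℚᵘ (j ℚ./ 1)       ≈⟨ ℚ.toℚᵘ-homo-* (i ℚ./ 1) (j ℚ./ 1) ⟨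
    ℚ.toℚᵘ ((i ℚ./ 1) ℚ.* (j ℚ./ 1))                 ∎)

/1-mono-≤ : ∀ {i j} → i ℤ.≤ j → i ℚ./ 1 ℚ.≤ j ℚ./ 1
/1-mono-≤ {i} {j} i≤j = ℚ.toℚᵘ-cancel-≤ (begin
  ℚ.toℚᵘ (i ℚ./ 1)   ≃⟨ ℚ.toℚᵘ-fromℚᵘ (ℚᵘ.mkℚᵘ i 0) ⟩
  ℚᵘ.mkℚᵘ i 0        ≤⟨ ℚᵘ.*≤* (ℤ.*-monoʳ-≤-nonNeg ℤ.1ℤ i≤j) ⟩
  ℚᵘ.mkℚᵘ j 0        ≃⟨ ℚ.toℚᵘ-fromℚᵘ (ℚᵘ.mkℚᵘ j 0) ⟨
  ℚ.toℚᵘ (j ℚ./ 1)   ∎)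
  where open ℚᵘ.≤-Reasoning

fromℕ-homo-+ : ∀ m n → fromℕ (m + n) ≡ fromℕ m ℚ.+ fromℕ n
fromℕ-homo-+ m n = /1-homo-+ (ℤ.+ m) (ℤ.+ n)

fromℕ-homo-* : ∀ m n → fromℕ (m * n) ≡ fromℕ m ℚ.* fromℕ n
fromℕ-homo-* m n = trans (cong (ℚ._/ 1) (ℤ.pos-* m n)) (/1-homo-* (ℤ.+ m) (ℤ.+ n))

fromℕ-homo-sum : ∀ a b c → fromℕ (a + b + c) ≡ fromℕ a ℚ.+ fromℕ b ℚ.+ fromℕ c
fromℕ-homo-sum a b c = trans (fromℕ-homo-+ (a + b) c) (cong (ℚ._+ fromℕ c) (fromℕ-homo-+ a b))

fromℕ-tripleRadicand : ∀ a b c →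
  fromℕ (tripleRadicand a b c) ≡ fromℕ 3 ℚ.* radicand (fromℕ a) (fromℕ b) (fromℕ c)
fromℕ-tripleRadicand a b c = begin
  fromℕ (tripleRadicand a b c)
    ≡⟨ fromℕ-homo-+ (s * (s + 2 * a * b * c)) (8 * e₂) ⟩
  fromℕ (s * (s + 2 * a * b * c)) ℚ.+ fromℕ (8 * e₂)
    ≡⟨ cong₂ ℚ._+_ (fromℕ-homo-* s _) (fromℕ-homo-* 8 e₂) ⟩
  fromℕ s ℚ.* fromℕ (s + 2 * a * b * c) ℚ.+ fromℕ 8 ℚ.* fromℕ e₂
    ≡⟨ cong₂ (λ p q → fromℕ s ℚ.* p ℚ.+ fromℕ 8 ℚ.* q)
         (trans (fromℕ-homo-+ s _) (cong (fromℕ s ℚ.+_) 2abc≡))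
         (trans (fromℕ-homo-sum (a * b) (b * c) (c * a))
           (cong₂ ℚ._+_ (cong₂ ℚ._+_ (fromℕ-homo-* a b) (fromℕ-homo-* b c)) (fromℕ-homo-* c a))) ⟩
  fromℕ s ℚ.* (fromℕ s ℚ.+ fromℕ 2 ℚ.* α ℚ.* β ℚ.* γ) ℚ.+ fromℕ 8 ℚ.* ε₂
    ≡⟨ cong (λ p → p ℚ.* (p ℚ.+ fromℕ 2 ℚ.* α ℚ.* β ℚ.* γ) ℚ.+ fromℕ 8 ℚ.* ε₂)
         (fromℕ-homo-sum a b c) ⟩
  σ ℚ.* (σ ℚ.+ fromℕ 2 ℚ.* α ℚ.* β ℚ.* γ) ℚ.+ fromℕ 8 ℚ.* ε₂
    -- Only the constants have to cancel, 3 against 1/3 and 8/3, so the product 2 α β γ stays atomic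
    -- as `τ`.
    ≡⟨ solve 3 (λ σ τ ε₂ → σ :* (σ :+ τ) :+ con (fromℕ 8) :* ε₂
         := con (fromℕ 3) :* (con (ℤ.+ 1 ℚ./ 3) :* σ :* (σ :+ τ) :+ con (ℤ.+ 8 ℚ./ 3) :* ε₂))
         refl σ (fromℕ 2 ℚ.* α ℚ.* β ℚ.* γ) ε₂ ⟩
  fromℕ 3 ℚ.* radicand α β γ ∎
  where
  open ≡-Reasoning
  open ℚ.+-*-Solver
  s = a + b + c
  e₂ = a * b + b * c + c * a
  α = fromℕ a
  β = fromℕ b
  γ = fromℕ c
  σ = α ℚ.+ β ℚ.+ γ
  ε₂ = α ℚ.* β ℚ.+ β ℚ.* γ ℚ.+ γ ℚ.* α
  2abc≡ : fromℕ (2 * a * b * c) ≡ fromℕ 2 ℚ.* α ℚ.* β ℚ.* γ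
  2abc≡ = trans (fromℕ-homo-* (2 * a * b) c) (cong (ℚ._* γ)
    (trans (fromℕ-homo-* (2 * a) b) (cong (ℚ._* β) (fromℕ-homo-* 2 a))))

square≤radicand : ∀ a b c w → 3 * (w * w) ≤ⁿ tripleRadicand a b c →
  fromℕ w ℚ.* fromℕ w ℚ.≤ radicand (fromℕ a) (fromℕ b) (fromℕ c)
square≤radicand a b c w 3w²≤ = ℚ.*-cancelˡ-≤-pos (fromℕ 3)
  (subst₂ ℚ._≤_
    (trans (fromℕ-homo-* 3 (w * w)) (cong (fromℕ 3 ℚ.*_) (fromℕ-homo-* w w)))
    (fromℕ-tripleRadicand a b c)
    (/1-mono-≤ (ℤ.+≤+ 3w²≤)))

-- From the integer bound to Dedekind cuts

square-mono-< : ∀ {p q} → 0ℚ ℚ.≤ p → p ℚ.< q → p ℚ.* p ℚ.< q ℚ.* q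
square-mono-< {p} {q} 0≤p p<q = ℚ.≤-<-trans
  (ℚ.*-monoˡ-≤-nonNeg p {{ℚ.nonNegative 0≤p}} (ℚ.<⇒≤ p<q))
  (ℚ.*-monoˡ-<-pos q {{ℚ.positive (ℚ.≤-<-trans 0≤p p<q)}} p<q)

-- Membership of q in the lower cut of `bound` unfolds to membership of p = q ÷ ½ + c + b + a in
-- that of the root. A negative p belongs to it outright. Otherwise q < F gives p < 2 F + a + b + c
-- ≤ w, and squaring gives p² < w² ≤ `radicand`.
hasBound⇒≤bound : ∀ a b c F → HasBound a b c F → fromℤ F ≤ʳ bound a b c
hasBound⇒≤bound a b c F (w , 2F+s≤w , 3w²≤) {q} q<F
  with q ℚ.÷ ℚ.½ ℚ.+ fromℕ c ℚ.+ fromℕ b ℚ.+ fromℕ a ℚ.<? 0ℚ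
... | yes p<0 = inj₁ p<0
... | no  p≮0 = inj₂ (ℚ.<-≤-trans (square-mono-< (ℚ.≮⇒≥ p≮0) p<w) (square≤radicand a b c w 3w²≤))
  where
  open ℚ.≤-Reasoning
  open ℚ.+-*-Solver
  p<w : q ℚ.÷ ℚ.½ ℚ.+ fromℕ c ℚ.+ fromℕ b ℚ.+ fromℕ a ℚ.< fromℕ w
  p<w = begin-strict
    q ℚ.÷ ℚ.½ ℚ.+ fromℕ c ℚ.+ fromℕ b ℚ.+ fromℕ a
      ≡⟨ solve 4 (λ q α β γ → q :* con (ℚ.1/ ℚ.½) :+ γ :+ β :+ α := (q :+ q) :+ (α :+ β :+ γ))
           refl q (fromℕ a) (fromℕ b) (fromℕ c) ⟩
    (q ℚ.+ q) ℚ.+ (fromℕ a ℚ.+ fromℕ b ℚ.+ fromℕ c)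
      <⟨ ℚ.+-monoˡ-< _ (ℚ.+-mono-< q<F q<F) ⟩
    (F ℚ./ 1 ℚ.+ F ℚ./ 1) ℚ.+ (fromℕ a ℚ.+ fromℕ b ℚ.+ fromℕ c)
      ≡⟨ cong₂ ℚ._+_ (/1-homo-+ F F) (fromℕ-homo-sum a b c) ⟨
    (F ℤ.+ F) ℚ./ 1 ℚ.+ fromℕ (a + b + c)
      ≡⟨ /1-homo-+ (F ℤ.+ F) (ℤ.+ (a + b + c)) ⟨
    (F ℤ.+ F ℤ.+ ℤ.+ (a + b + c)) ℚ./ 1
      ≤⟨ /1-mono-≤ 2F+s≤w ⟩
    fromℕ w ∎

-- From three generators to n

-- The remaining generators get coefficient 0. Contrapositively, a number not representable by all
-- entries is not representable by the first three.
representable₃⇒representable : ∀ {n} (a : Vector ℕ (3 + n)) {m} →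
  Representable₃ (a 0F) (a 1F) (a 2F) m → Representable a (ℤ.+ m)
representable₃⇒representable {n} a {m} (x , y , z , m≡) = coeff , cong ℤ.+_ (begin
  m                                             ≡⟨ m≡ ⟩
  x * a 0F + y * a 1F + z * a 2F                ≡⟨ regroup x y z (a 0F) (a 1F) (a 2F) ⟩
  a 0F * x + (a 1F * y + (a 2F * z + 0))        ≡⟨ cong (λ r → a 0F * x + (a 1F * y + (a 2F * z + r))) rest≡0 ⟨
  a 0F * x + (a 1F * y + (a 2F * z + sum rest)) ∎)
  where
  open ≡-Reasoning
  coeff : Vector ℕ (3 + n)
  coeff 0F                  = x
  coeff 1F                  = y
  coeff 2F                  = z
  coeff (suc (suc (suc _))) = 0
  rest : Vector ℕ n
  rest i = a (suc (suc (suc i))) * 0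
  rest≡0 : sum rest ≡ 0
  rest≡0 = trans (sum-cong-≗ (λ i → ℕ.*-zeroʳ (a (suc (suc (suc i)))))) (sum-replicate-zero n)
  regroup : ∀ x y z a b c → x * a + y * b + z * c ≡ a * x + (b * y + (c * z + 0))
  regroup = ℕ-Ring.solve-∀

theorem1 : ∀ {n : ℕ} (3≤n : 3 ≤ⁿ n) (a : Vector ℕ n) →
    (∀ i → 0 < a i) →
    (∀ {i j : Fin n} → i ≤ j → a i ≤ⁿ a j) →
    (∀ {i j : Fin n} → i ≢ j → gcd (a i) (a j) ≡ 1) →
    (F : ℤ) → IsFrobeniusNumber a F →
    let a₁ = a (inject≤ {3} 0F 3≤n)
        a₂ = a (inject≤ {3} 1F 3≤n)
        a₃ = a (inject≤ {3} 2F 3≤n)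
    in fromℤ F ≤ʳ bound a₁ a₂ a₃
-- Matching on `3≤n` exposes three successors in n, so that the `inject≤` indices compute to `0F`,
-- `1F` and `2F`.
theorem1 (s≤s (s≤s (s≤s z≤n))) a 0<a mono coprime F isFrobenius =
  hasBound⇒≤bound (a 0F) (a 1F) (a 2F) F (hasBound (0<a 0F) (mono z≤n) (mono (s≤s z≤n))
    (coprime λ ()) (coprime λ ()) (coprime λ ()) F
    λ { m refl rep → IsFrobeniusNumber.notRepresentable isFrobenius
                       (representable₃⇒representable a rep) })
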